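{- Let $r(\mathcal{C},R)$ be a reachability rule and $\mathrm{H}$ a set of Horn rules. Then $r(\mathcal{C},R)\oplus\mathbf{G}(\mathrm{H})$ and $\mathrm{H}$ are permutable (each permutes above the other).
   Context: Fix a countably infinite set $\mathtt{S}$ of sequents (atomic labels), a set $\mathcal{U}$ of vertices, and a non-empty finite set $\mathtt{E}$ of edge types. A g-sequent is $\mathcal{G}=(\mathcal{V},\mathcal{E},\mathcal{L})$ with $\mathcal{V}\subseteq\mathcal{U}$, $\mathcal{E}=\{\mathcal{E}_a\mid a\in\mathtt{E}\}$, $\mathcal{E}_a\subseteq\mathcal{V}\times\mathcal{V}$, $\mathcal{L}:\mathcal{V}\to\mathtt{S}$; $\mathcal U(\mathcal G):=\mathcal V$. It is written $\Gamma\vdash\Delta$ with $\Gamma$ the set of edge atoms $w\mathcal{E}_a u$ ($(w,u)\in\mathcal{E}_a$) and $\Delta$ the set of prefixed sequents $w:S$ ($\mathcal{L}(w)=S$); $\mathtt{PS}=\mathcal{U}\times\mathtt{S}$; commas denote disjoint union. Let $\overline{\mathtt E}=\{\bar a\mid a\in\mathtt E\}$, $\bar{\bar z}=z$, and for a string $s=x_1\cdots x_n$ over $\mathtt E\cup\overline{\mathtt E}$ let $\bar s=\bar x_n\cdots\bar x_1$; $\varepsilon$ is the empty string. Paths: $\mathcal{G}\models u\xrightarrow{a}w$ iff $(u,w)\in\mathcal{E}_a$; $\mathcal{G}\models u\xrightarrow{\bar a}w$ iff $(w,u)\in\mathcal{E}_a$; $\mathcal G\models u\xrightarrow{\varepsilon}w$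 iff $u=w$; $\mathcal{G}\models u\xrightarrow{xs}w$ iff some $v\in\mathcal V$ has $u\xrightarrow{x}v$ and $v\xrightarrow{s}w$; for a set $\mathscr L$ of strings, $u\xrightarrow{\mathscr L}w$ iff $u\xrightarrow{s}w$ for some $s\in\mathscr L$. An $\mathtt{E}$-system is a finite set $\mathbf{G}$ of production rules $x\longrightarrow t$ with $x\in\mathtt{E}\cup\overline{\mathtt{E}}$ and $t$ a string, such that $x\longrightarrow t\in\mathbf{G}$ iff $\bar x\longrightarrow\bar t\in\mathbf{G}$. $t\longrightarrow_{\mathbf{G}}t'$ iff $t'$ arises from $t$ by replacing one occurrence of the left side of a rule of $\mathbf G$ by its right side; $\longrightarrow^*_{\mathbf G}$ is its reflexive-transitive closure, and $\mathbf{G}(s)=\{t\mid s\longrightarrow^*_{\mathbf{G}}t\}$. A sequent constraint is a relation $R\subseteq\mathtt{S}^n\times 2^{\mathtt{PS}}$; $S_1,\dots,S_n,\Delta$ satisfy $R$ iff $(S_{\pi(1)},\dots,S_{\pi(n)},\Delta)\in R$ for some permutation $\pi$. A reachability rule $r(\mathcal C,R)$ has premises $\Gamma\vdash\Delta,w:S_i,u:S'_i$ ($i\in[n]$) and conclusion $\Gamma\vdash\Delta,w:S,u:S'$, where $\mathcal{C}=(C_1,\dots,C_n)$, each $C_i$ is a one-edge tree $(\{w,u\},\{(w,u)\},L_i)$ with $L_i(w,u)=\mathbf{G}_i(a_i)$ for some $a_i\in\mathtt E$ and $\mathtt E$-system $\mathbf G_i$, the $i$-th premise satisfies $\mathcal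 G\models w\xrightarrow{\mathbf G_i(a_i)}u$, and $S_1,S'_1,\dots,S_n,S'_n,S,S',\Delta$ satisfy $R$. For a string $s=x_1\cdots x_n$, $w\mathcal{E}_s u$ abbreviates edge atoms $w\mathcal{E}_{x_1}v_1,\dots,v_{n-1}\mathcal{E}_{x_n}u$, where $v\mathcal E_{\bar a}z$ means $z\mathcal E_a v$ and $w\mathcal E_\varepsilon u$ means $w=u$. A forward Horn rule $h_f$ (for $a\in\mathtt E$, string $s$) has premise $\Gamma,w\mathcal{E}_s u,w\mathcal{E}_a u\vdash\Delta$ and conclusion $\Gamma,w\mathcal{E}_s u\vdash\Delta$; a backward Horn rule $h_b$ is the same with $w\mathcal{E}_a u$ replaced by $u\mathcal{E}_a w$. Their grammars are $\mathbf{G}(h_f)=\{a\longrightarrow s,\bar a\longrightarrow\bar s\}$ and $\mathbf{G}(h_b)=\{\bar a\longrightarrow s,a\longrightarrow\bar s\}$; for a set $\mathrm H$ of Horn rules $\mathbf G(\mathrm H)$ is the union of their grammars. Absorb: $r(\mathcal C,R)\oplus\mathbf G$ is the reachability rule $r(\mathcal C',R)$ where each label $\mathbf G_i(a_i)$ of $\mathcal C$ is replaced by $(\mathbf G_i\cup\mathbf G)(a_i)$. Permutation: $\mathrm{R}_1$ permutes above $\mathrm{R}_2$ iff whenever $\mathcal{G}$ is obtained from $\mathcal{G}_1,\dots,\mathcal{G}_n$ by an application of some $\sigma\in\mathrm{R}_2$ followed by an application of some $\rho\in\mathrm{R}_1$, then $\mathcal{G}$ can be obtained from $\mathcal{G}_1,\dots,\mathcal{G}_n$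 by applications of $\rho$ followed by an application of $\sigma$; permutable means each permutes above the other.
   Formalization: For a reachability rule with several premises, "an application of σ followed by one of ρ" means that σ is applied above every premise of ρ, for Horn rules always removing the same edge; if a Horn rule is applied above only some premises, the claim is false, since premises must share Γ. -}

module Defs where

open import Data.Fin.Base using (Fin; zero)
open import Data.Fin.Permutation using (Permutation′; _⟨$⟩ʳ_)
open import Data.List.Base using (List; []; _∷_; _++_; map; reverse; foldr; [_])
open import Data.List.Membership.Propositional using (_∈_)
open import Data.List.Membership.Propositional.Properties using (∈-++⁺ˡ; ∈-++⁺ʳ; ∈-++⁻)
open import Data.List.Properties using (reverse-map; reverse-involutive; map-∘; map-cong; map-id)
open import Data.List.Relation.Unary.AllPairs using (AllPairs)
open import Data.Nat.Base using (ℕ; suc; _+_; _*_; NonZero)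
open import Data.Product.Base using (Σ; ∃; ∃₂; _×_; _,_; proj₁; proj₂)
open import Data.Sum.Base using (inj₁; inj₂)
open import Data.Vec.Base as Vec using (Vec; []; _∷_)
open import Function.Base using (flip)
open import Function.Bundles using (_↔_; _⇔_; mk⇔; Equivalence)
open import Level using (Level; 0ℓ; _⊔_) renaming (suc to lsuc)
open import Relation.Binary.Construct.Closure.ReflexiveTransitive using (Star)
open import Relation.Binary.PropositionalEquality using (_≡_; refl; sym; trans; cong; subst)
open import Relation.Unary using (Pred; ∅; _∪_; _⊥_; _≐_; ｛_｝)

Finite : {A : Set} → Pred A 0ℓ → Set
Finite {A} P = ∃ λ (xs : List A) → P ≐ (_∈ xs)

-- X is the disjoint union of the sets in the list; this is what the commas in
-- "Γ , Γ′ ⊢ Δ , Δ′" stand for.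
infix 4 _≐⨄_
_≐⨄_ : {A : Set} → Pred A 0ℓ → List (Pred A 0ℓ) → Set₁
X ≐⨄ Ps = (X ≐ foldr _∪_ ∅ Ps) × AllPairs _⊥_ Ps

record Signature : Set₁ where
  field
    𝒰           : Set
    𝖲           : Set
    𝖲-countable : 𝖲 ↔ ℕ
    𝖤           : Set
    k           : ℕ
    𝖤-finite    : 𝖤 ↔ Fin (suc k)

module Calculus (Sig : Signature) where
  open Signature Sig

  data Letter : Set where
    fwd bwd : 𝖤 → Letter

  String : Set
  String = List Letter

  bar : Letter → Letter
  bar (fwd a) = bwd a
  bar (bwd a) = fwd a

  bar* : String → String
  bar* s = reverse (map bar s)

  bar-involutive : ∀ x → bar (bar x) ≡ x
  bar-involutive (fwd a) = refl
  bar-involutive (bwd a) = refl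

  bar*-involutive : ∀ s → bar* (bar* s) ≡ s
  bar*-involutive s =
    trans (cong reverse (reverse-map bar (map bar s)))
      (trans (reverse-involutive (map bar (map bar s)))
        (trans (sym (map-∘ s)) (trans (map-cong bar-involutive s) (map-id s))))

  EdgeAtom : Set
  EdgeAtom = 𝖤 × 𝒰 × 𝒰

  PS : Set
  PS = 𝒰 × 𝖲

  -- Sequents label the vertices of a subset 𝒱 of 𝒰, so ℒ takes a membership
  -- proof, on which its value must not depend.
  record GSequent : Set₁ where
    field
      𝒱            : Pred 𝒰 0ℓ
      ℰ            : 𝖤 → 𝒰 → 𝒰 → Set
      ℰ⊆𝒱×𝒱        : ∀ {a w u} → ℰ a w u → 𝒱 w × 𝒱 u
      ℒ            : ∀ w → 𝒱 w → 𝖲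
      ℒ-irrelevant : ∀ w (p q : 𝒱 w) → ℒ w p ≡ ℒ w q

    edgeAtoms : Pred EdgeAtom 0ℓ
    edgeAtoms (a , w , u) = ℰ a w u

    prefixed : Pred PS 0ℓ
    prefixed (w , S) = Σ (𝒱 w) λ p → ℒ w p ≡ S

  open GSequent

  infix 3 _is_⊢_
  _is_⊢_ : GSequent → List (Pred EdgeAtom 0ℓ) → List (Pred PS 0ℓ) → Set₁
  G is Γs ⊢ Δs = (edgeAtoms G ≐⨄ Γs) × (prefixed G ≐⨄ Δs)

  atom : Letter → 𝒰 → 𝒰 → EdgeAtom
  atom (fwd a) v z = a , v , z
  atom (bwd a) v z = a , z , v

  infix 3 _⊨_⟶⟨_⟩_ _⊨_⟶[_]_

  _⊨_⟶⟨_⟩_ : GSequent → 𝒰 → String → 𝒰 → Set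
  G ⊨ u ⟶⟨ [] ⟩ w    = u ≡ w
  G ⊨ u ⟶⟨ x ∷ s ⟩ w = ∃ λ v → 𝒱 G v × edgeAtoms G (atom x u v) × (G ⊨ v ⟶⟨ s ⟩ w)

  _⊨_⟶[_]_ : GSequent → 𝒰 → Pred String 0ℓ → 𝒰 → Set
  G ⊨ u ⟶[ 𝓛 ] w = ∃ λ s → 𝓛 s × (G ⊨ u ⟶⟨ s ⟩ w)

  Production : Set
  Production = Letter × String

  barᴾ : Production → Production
  barᴾ (x , t) = bar x , bar* t

  record ESystem : Set₁ where
    field
      rules  : Pred Production 0ℓ
      finite : Finite rules
      closed : ∀ p → rules p ⇔ rules (barᴾ p)

  open ESystem

  Step : ESystem → String → String → Set
  Step 𝐆 t t′ = ∃₂ λ pre post → ∃₂ λ x r →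
    rules 𝐆 (x , r) × t ≡ pre ++ x ∷ post × t′ ≡ pre ++ r ++ post

  language : ESystem → String → Pred String 0ℓ
  language 𝐆 s t = Star (Step 𝐆) s t

  infixl 6 _∪ᴳ_
  _∪ᴳ_ : ESystem → ESystem → ESystem
  rules (𝐆 ∪ᴳ 𝐆′) = rules 𝐆 ∪ rules 𝐆′
  finite (𝐆 ∪ᴳ 𝐆′) with finite 𝐆 | finite 𝐆′
  ... | xs , (to , from) | ys , (to′ , from′) =
    xs ++ ys
    , (λ { (inj₁ p) → ∈-++⁺ˡ (to p) ; (inj₂ p) → ∈-++⁺ʳ xs (to′ p) })
    , λ m → case m
    where
    case : ∀ {p} → p ∈ xs ++ ys → (rules 𝐆 ∪ rules 𝐆′) p
    case m with ∈-++⁻ xs m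
    ... | inj₁ l = inj₁ (from l)
    ... | inj₂ r = inj₂ (from′ r)
  closed (𝐆 ∪ᴳ 𝐆′) p = mk⇔
    (λ { (inj₁ q) → inj₁ (Equivalence.to (closed 𝐆 p) q)
       ; (inj₂ q) → inj₂ (Equivalence.to (closed 𝐆′ p) q) })
    (λ { (inj₁ q) → inj₁ (Equivalence.from (closed 𝐆 p) q)
       ; (inj₂ q) → inj₂ (Equivalence.from (closed 𝐆′ p) q) })

  -- Instance holds the vertices w and u of an application.  Applications of one
  -- rule in different branches that agree on it count as the same application;
  -- for a Horn rule this means that they remove the same edge atom.
  record Rule : Set₂ where
    field
      arity    : ℕ
      Instance : Set
      Infers   : Instance → (Fin arity → GSequent) → GSequent → Set₁

  open Rule

  -- A subset of 𝖲ⁿ × 2^PS; as its second argument is a set, membership may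
  -- not distinguish extensionally equal predicates.
  record SequentConstraint (n : ℕ) : Set₁ where
    field
      rel  : Vec 𝖲 n → Pred PS 0ℓ → Set
      resp : ∀ Ss {Δ Δ′} → Δ ≐ Δ′ → rel Ss Δ → rel Ss Δ′

  open SequentConstraint

  Satisfies : ∀ {n} → SequentConstraint n → Vec 𝖲 n → Pred PS 0ℓ → Set
  Satisfies {n} R Ss Δ = ∃ λ (π : Permutation′ n) →
    rel R (Vec.tabulate λ i → Vec.lookup Ss (π ⟨$⟩ʳ i)) Δ

  -- A tree with the single edge (w,u) is determined by the label 𝐆ᵢ(aᵢ) of
  -- that edge; w and u are schematic, and are fixed by each application.
  record ReachabilityRule : Set₁ where
    field
      n        : ℕ
      system   : Fin n → ESystem
      edgeType : Fin n → 𝖤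
      R        : SequentConstraint (n * 2 + 2)

    label : Fin n → Pred String 0ℓ
    label i = language (system i) [ fwd (edgeType i) ]

  -- The sequence S₁ , S′₁ , … , Sₙ , S′ₙ , S , S′.
  sequents : ∀ {n} → (Fin n → 𝖲) → (Fin n → 𝖲) → 𝖲 → 𝖲 → Vec 𝖲 (n * 2 + 2)
  sequents Sᵢ Sᵢ′ S S′ =
    Vec.concat (Vec.tabulate λ i → Sᵢ i ∷ Sᵢ′ i ∷ []) Vec.++ (S ∷ S′ ∷ [])

  reachability : ReachabilityRule → Rule
  reachability r = record
    { arity    = n
    ; Instance = 𝒰 × 𝒰
    ; Infers   = λ (w , u) 𝒢 G →
        ∃₂ λ (Γ : Pred EdgeAtom 0ℓ) (Δ : Pred PS 0ℓ) →
        ∃₂ λ (Sᵢ Sᵢ′ : Fin n → 𝖲) →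
        ∃₂ λ (S S′ : 𝖲) →
          (∀ i → 𝒢 i is Γ ∷ [] ⊢ Δ ∷ ｛ w , Sᵢ i ｝ ∷ ｛ u , Sᵢ′ i ｝ ∷ [])
          × (G is Γ ∷ [] ⊢ Δ ∷ ｛ w , S ｝ ∷ ｛ u , S′ ｝ ∷ [])
          × (∀ i → 𝒢 i ⊨ w ⟶[ label i ] u)
          × Satisfies R (sequents Sᵢ Sᵢ′ S S′) Δ
    }
    where open ReachabilityRule r

  infixl 6 _⊕_
  _⊕_ : ReachabilityRule → ESystem → ReachabilityRule
  r ⊕ 𝐆 = record
    { n = n ; system = λ i → system i ∪ᴳ 𝐆 ; edgeType = edgeType ; R = R }
    where open ReachabilityRule r

  data HornRule : Set where
    forward backward : (a : 𝖤) (s : String) → HornRule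

  body : HornRule → String
  body (forward a s)  = s
  body (backward a s) = s

  active : HornRule → 𝒰 → 𝒰 → EdgeAtom
  active (forward a s)  w u = a , w , u
  active (backward a s) w u = a , u , w

  -- A choice of the vertices v₁ , … , vₙ₋₁ in w ℰₛ u.
  data Walk : 𝒰 → String → 𝒰 → Set where
    []     : ∀ {w} → Walk w [] w
    _∷⟨_⟩_ : ∀ {w s u} (x : Letter) (v : 𝒰) → Walk v s u → Walk w (x ∷ s) u

  -- The set of atoms abbreviated by w ℰₛ u; a walk may use an edge twice.
  atoms : ∀ {w s u} → Walk w s u → Pred EdgeAtom 0ℓ
  atoms []                   = ∅
  atoms {w} (x ∷⟨ v ⟩ walk)  = ｛ atom x w v ｝ ∪ atoms walk

  horn : HornRule → Rule
  horn h = record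
    { arity    = 1
    ; Instance = 𝒰 × 𝒰
    ; Infers   = λ (w , u) 𝒢 G →
        ∃ λ (walk : Walk w (body h) u) →
        ∃₂ λ (Γ : Pred EdgeAtom 0ℓ) (Δ : Pred PS 0ℓ) →
          (𝒢 zero is Γ ∷ atoms walk ∷ ｛ active h w u ｝ ∷ [] ⊢ Δ ∷ [])
          × (G is Γ ∷ atoms walk ∷ [] ⊢ Δ ∷ [])
    }

  hornGrammar : HornRule → Pred Production 0ℓ
  hornGrammar (forward a s)  = ｛ fwd a , s ｝ ∪ ｛ bwd a , bar* s ｝
  hornGrammar (backward a s) = ｛ bwd a , s ｝ ∪ ｛ fwd a , bar* s ｝

  hornGrammars : Pred HornRule 0ℓ → Pred Production 0ℓ
  hornGrammars H p = ∃ λ h → H h × hornGrammar h p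

  hornGrammar-closed : ∀ h p → hornGrammar h p → hornGrammar h (barᴾ p)
  hornGrammar-closed (forward a s) _ (inj₁ refl)  = inj₂ refl
  hornGrammar-closed (forward a s) _ (inj₂ refl)  =
    inj₁ (cong (fwd a ,_) (sym (bar*-involutive s)))
  hornGrammar-closed (backward a s) _ (inj₁ refl) = inj₂ refl
  hornGrammar-closed (backward a s) _ (inj₂ refl) =
    inj₁ (cong (bwd a ,_) (sym (bar*-involutive s)))

  barᴾ-involutive : ∀ p → barᴾ (barᴾ p) ≡ p
  barᴾ-involutive (x , t) rewrite bar-involutive x | bar*-involutive t = refl

  -- An 𝖤-system is finite, so 𝐆(H) is one only if it has finitely many rules.
  𝐆 : (H : Pred HornRule 0ℓ) → Finite (hornGrammars H) → ESystem
  𝐆 H fin = record { rules = hornGrammars H ; finite = fin ; closed = closed′ }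
    where
    to : ∀ p → hornGrammars H p → hornGrammars H (barᴾ p)
    to p (h , h∈H , q) = h , h∈H , hornGrammar-closed h p q

    closed′ : ∀ p → hornGrammars H p ⇔ hornGrammars H (barᴾ p)
    closed′ p = mk⇔ (to p)
      (λ q → subst (hornGrammars H) (barᴾ-involutive p) (to (barᴾ p) q))

  hornRules : Pred HornRule 0ℓ → Pred Rule (lsuc (lsuc 0ℓ))
  hornRules H ρ = ∃ λ h → H h × ρ ≡ horn h

  -- An application of σ followed by an application of ρ.  The application of σ
  -- is carried out on every premise of ρ (of which there is at least one), and
  -- is the same one throughout: ρ may require its premises to share their edge
  -- atoms, so an application of σ to some premises only, or acting on different
  -- edges in different premises, could not be postponed until after ρ.
  OnceThen : (σ ρ : Rule) → (Fin (arity ρ) → Fin (arity σ) → GSequent) → GSequent → Set₁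
  OnceThen σ ρ 𝒢 G =
    NonZero (arity ρ)
    × ∃₂ λ (ι : Instance σ) (𝒢′ : Fin (arity ρ) → GSequent) →
      (∀ j → Infers σ ι (𝒢 j) (𝒢′ j)) × ∃ λ κ → Infers ρ κ 𝒢′ G

  -- Applications of σ, one for each premise of ρ, followed by one of ρ.
  ManyThen : (σ ρ : Rule) → (Fin (arity ρ) → Fin (arity σ) → GSequent) → GSequent → Set₁
  ManyThen σ ρ 𝒢 G =
    ∃ λ (𝒢′ : Fin (arity ρ) → GSequent) →
      (∀ j → ∃ λ ι → Infers σ ι (𝒢 j) (𝒢′ j)) × ∃ λ κ → Infers ρ κ 𝒢′ G

  private variable ℓ₁ ℓ₂ : Level

  -- With a premise 𝒢 i j above premise i of the lower rule ρ, the same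
  -- sequents are regrouped, by flip, above the premises j of σ.
  _PermutesAbove_ : Pred Rule ℓ₁ → Pred Rule ℓ₂ → Set (lsuc (lsuc 0ℓ) ⊔ ℓ₁ ⊔ ℓ₂)
  R₁ PermutesAbove R₂ = ∀ ρ σ → R₁ ρ → R₂ σ →
    ∀ 𝒢 G → OnceThen σ ρ 𝒢 G → ManyThen ρ σ (flip 𝒢) G

  Permutable : Pred Rule ℓ₁ → Pred Rule ℓ₂ → Set (lsuc (lsuc 0ℓ) ⊔ ℓ₁ ⊔ ℓ₂)
  Permutable R₁ R₂ = (R₁ PermutesAbove R₂) × (R₂ PermutesAbove R₁)

{-# OPTIONS --safe #-}
-- Both rules leave each other's part of the sequent alone: a reachability rule
-- changes two labels and a Horn rule removes one edge.  Only the side condition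
-- on paths needs an argument.  Adding an edge preserves paths; after removing
-- the edge atom concluded from w ℰₛ u, each traversal of that edge in a path is
-- replaced by s (or by bar* s, in the other direction), and this rewriting of
-- the path's string is a derivation in 𝐆(H).
module Submission where

open import Defs
open import Data.Fin.Base using (Fin; zero)
open import Data.List.Base using (List; []; _∷_; _++_; map; [_])
open import Data.List.Properties using (++-assoc; ++-identityʳ; unfold-reverse)
open import Data.List.Relation.Unary.All using ([])
open import Data.List.Relation.Unary.AllPairs using ([]; _∷_)
open import Data.Nat.Base using (suc)
open import Data.Product.Base using (_×_; _,_; proj₁; proj₂)
open import Data.Sum.Base using (inj₁; inj₂; [_,_]′)
open import Function.Base using (_∘_; id)
open import Level using (0ℓ)
open import Relation.Binary.Construct.Closure.ReflexiveTransitive using (ε; _◅_; _◅◅_; gmap)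
open import Relation.Binary.PropositionalEquality using (_≡_; refl; sym; trans; cong; subst)
open import Relation.Unary using (Pred; ∅; _∪_; _⊆_; _≐_; ｛_｝)
open import Relation.Unary.Properties using (≐-refl; ≐-sym; ≐-trans)

-- Decompositions into disjoint unions

≐-≐⨄-trans : {A : Set} {X Y : Pred A 0ℓ} {Ps : List (Pred A 0ℓ)} → X ≐ Y → Y ≐⨄ Ps → X ≐⨄ Ps
≐-≐⨄-trans X≐Y (Y≐ , disj) = ≐-trans X≐Y Y≐ , disj

∪-∅ : {A : Set} (X : Pred A 0ℓ) → X ≐ X ∪ ∅
∪-∅ X = inj₁ , [ id , (λ ()) ]′

≐⇒≐⨄ : {A : Set} {X Y : Pred A 0ℓ} → X ≐ Y → X ≐⨄ Y ∷ []
≐⇒≐⨄ {Y = Y} X≐Y = ≐-trans X≐Y (∪-∅ Y) , [] ∷ []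

≐⨄⇒≐ : {A : Set} {X Y : Pred A 0ℓ} → X ≐⨄ Y ∷ [] → X ≐ Y
≐⨄⇒≐ {Y = Y} (X≐ , _) = ≐-trans X≐ (≐-sym (∪-∅ Y))

∪-congˡ : {A : Set} {X Y Z : Pred A 0ℓ} → X ≐ Y → X ∪ Z ≐ Y ∪ Z
∪-congˡ (f , g) = [ inj₁ ∘ f , inj₂ ]′ , [ inj₁ ∘ g , inj₂ ]′

module _ {A : Set} {X Y B C D : Pred A 0ℓ} where

  -- Meant for a Horn rule: `Y` and `X` are the edge atoms of premise and conclusion, `B` the
  -- context, `C` the walk and `D` the active atom.
  ≐⨄-∪ : Y ≐⨄ B ∷ C ∷ D ∷ [] → X ≐⨄ B ∷ C ∷ [] → Y ≐ X ∪ D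
  ≐⨄-∪ ((f , g) , _) ((f′ , g′) , _) = to ∘ f , from
    where
    to : B ∪ C ∪ D ∪ ∅ ⊆ X ∪ D
    to (inj₁ b)               = inj₁ (g′ (inj₁ b))
    to (inj₂ (inj₁ c))        = inj₁ (g′ (inj₂ (inj₁ c)))
    to (inj₂ (inj₂ (inj₁ d))) = inj₂ d
    from : X ∪ D ⊆ Y
    from (inj₂ d) = g (inj₂ (inj₂ (inj₁ d)))
    from (inj₁ x) with f′ x
    ... | inj₁ b        = g (inj₁ b)
    ... | inj₂ (inj₁ c) = g (inj₂ (inj₁ c))

  -- The disjointness of `D` from `B` and `C` is inherited from `Y`. This lets a Horn rule be
  -- applied again once its active atom has been put back.
  ≐⨄-extend : X ≐⨄ B ∷ C ∷ [] → Y ≐⨄ B ∷ C ∷ D ∷ [] → X ∪ D ≐⨄ B ∷ C ∷ D ∷ []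
  ≐⨄-extend X≐ Y≐ = ≐-≐⨄-trans (≐-sym (≐⨄-∪ Y≐ X≐)) Y≐

module _ {Sig : Signature} where
  open Calculus Sig
  open GSequent
  open ESystem

  private variable
    G G′ : GSequent

  -- Builds the intermediate sequents of the permuted derivations. `prefixed` is unchanged and
  -- `edgeAtoms` computes to `E`, so their decompositions can often be given by reflexivity.
  withEdges : (G : GSequent) (E : Pred EdgeAtom 0ℓ) →
              (∀ {a w u} → E (a , w , u) → 𝒱 G w × 𝒱 G u) → GSequent
  withEdges G E E⊆ = record
    { 𝒱 = 𝒱 G ; ℰ = λ a w u → E (a , w , u) ; ℰ⊆𝒱×𝒱 = E⊆
    ; ℒ = ℒ G ; ℒ-irrelevant = ℒ-irrelevant G }

  prefixed-⊆⇒𝒱-⊆ : prefixed G ⊆ prefixed G′ → 𝒱 G ⊆ 𝒱 G′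
  prefixed-⊆⇒𝒱-⊆ sub p = proj₁ (sub (p , refl))

  -- A vertex is a first component of `prefixed`, so it comes from `Δ` or is `w` or `u`, whatever
  -- the labels of these two are.
  relabelling-𝒱-⊆ : ∀ {Δ w u S S′ T T′} →
    prefixed G ≐⨄ Δ ∷ ｛ w , S ｝ ∷ ｛ u , S′ ｝ ∷ [] →
    prefixed G′ ≐⨄ Δ ∷ ｛ w , T ｝ ∷ ｛ u , T′ ｝ ∷ [] →
    𝒱 G ⊆ 𝒱 G′
  relabelling-𝒱-⊆ ((to , _) , _) ((_ , from) , _) p with to (p , refl)
  ... | inj₁ δ                   = proj₁ (from (inj₁ δ))
  ... | inj₂ (inj₁ refl)         = proj₁ (from (inj₂ (inj₁ refl)))
  ... | inj₂ (inj₂ (inj₁ refl))  = proj₁ (from (inj₂ (inj₂ (inj₁ refl))))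

  -- Paths

  ⟶-mono : 𝒱 G ⊆ 𝒱 G′ → edgeAtoms G ⊆ edgeAtoms G′ →
           ∀ {u w} s → G ⊨ u ⟶⟨ s ⟩ w → G′ ⊨ u ⟶⟨ s ⟩ w
  ⟶-mono 𝒱⊆ ℰ⊆ [] u≡w = u≡w
  ⟶-mono {G} {G′} 𝒱⊆ ℰ⊆ (x ∷ s) (v , v∈𝒱 , e , p) =
    v , 𝒱⊆ v∈𝒱 , ℰ⊆ e , ⟶-mono {G} {G′} 𝒱⊆ ℰ⊆ s p

  ⟶-++ : ∀ (G : GSequent) {u v w} s t → G ⊨ u ⟶⟨ s ⟩ v → G ⊨ v ⟶⟨ t ⟩ w → G ⊨ u ⟶⟨ s ++ t ⟩ w
  ⟶-++ G []      t refl              q = q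
  ⟶-++ G (x ∷ s) t (z , z∈𝒱 , e , p) q = z , z∈𝒱 , e , ⟶-++ G s t p q

  atom-∈⇒𝒱 : ∀ (G : GSequent) x {v z} → edgeAtoms G (atom x v z) → 𝒱 G v × 𝒱 G z
  atom-∈⇒𝒱 G (fwd a) e = ℰ⊆𝒱×𝒱 G e
  atom-∈⇒𝒱 G (bwd a) e = let z∈ , v∈ = ℰ⊆𝒱×𝒱 G e in v∈ , z∈

  atom-bar : ∀ x v z → atom x v z ≡ atom (bar x) z v
  atom-bar (fwd a) v z = refl
  atom-bar (bwd a) v z = refl

  ⟶-bar* : ∀ (G : GSequent) {u w} s → G ⊨ u ⟶⟨ s ⟩ w → G ⊨ w ⟶⟨ bar* s ⟩ u
  ⟶-bar* G [] refl = refl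
  ⟶-bar* G {u} {w} (x ∷ s) (v , _ , e , p) =
    subst (λ t → G ⊨ w ⟶⟨ t ⟩ u) (sym (unfold-reverse (bar x) (map bar s)))
      (⟶-++ G (bar* s) [ bar x ] (⟶-bar* G s p)
        (u , proj₁ (atom-∈⇒𝒱 G x e) , subst (edgeAtoms G) (atom-bar x u v) e , refl))

  Walk⇒⟶ : ∀ (G : GSequent) {w s u} (walk : Walk w s u) →
            atoms walk ⊆ edgeAtoms G → G ⊨ w ⟶⟨ s ⟩ u
  Walk⇒⟶ G []              sub = refl
  Walk⇒⟶ G (x ∷⟨ v ⟩ walk) sub =
    v , proj₂ (atom-∈⇒𝒱 G x (sub (inj₁ refl))) , sub (inj₁ refl) , Walk⇒⟶ G walk (sub ∘ inj₂)

  -- Derivations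

  Step-++ʳ : ∀ (𝐒 : ESystem) {s s′} t → Step 𝐒 s s′ → Step 𝐒 (s ++ t) (s′ ++ t)
  Step-++ʳ 𝐒 t (pre , post , x , r , rule , refl , refl) =
    pre , post ++ t , x , r , rule , ++-assoc pre (x ∷ post) t ,
    trans (++-assoc pre (r ++ post) t) (cong (pre ++_) (++-assoc r post t))

  Step-++ˡ : ∀ (𝐒 : ESystem) {s s′} t → Step 𝐒 s s′ → Step 𝐒 (t ++ s) (t ++ s′)
  Step-++ˡ 𝐒 t (pre , post , x , r , rule , refl , refl) =
    t ++ pre , post , x , r , rule , sym (++-assoc t pre (x ∷ post)) , sym (++-assoc t pre (r ++ post))

  language-++ : ∀ (𝐒 : ESystem) {s s′ t t′} →
    language 𝐒 s s′ → language 𝐒 t t′ → language 𝐒 (s ++ t) (s′ ++ t′)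
  language-++ 𝐒 {s′ = s′} {t} ss′ tt′ =
    gmap (_++ t) (Step-++ʳ 𝐒 t) ss′ ◅◅ gmap (s′ ++_) (Step-++ˡ 𝐒 s′) tt′

  rule⇒language : ∀ (𝐒 : ESystem) {x t} → rules 𝐒 (x , t) → language 𝐒 [ x ] t
  rule⇒language 𝐒 {x} {t} rule =
    ([] , [] , x , t , rule , refl , sym (++-identityʳ t)) ◅ ε

  -- Each letter gives way to a path whose string it derives. Derivation is a congruence for
  -- concatenation, so the pieces join to one derivation from `s`.
  ⟶-derive : ∀ (𝐒 : ESystem) →
    (∀ x {v z} → edgeAtoms G (atom x v z) → G′ ⊨ v ⟶[ language 𝐒 [ x ] ] z) →
    ∀ {u w} s → G ⊨ u ⟶⟨ s ⟩ w → G′ ⊨ u ⟶[ language 𝐒 s ] w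
  ⟶-derive 𝐒 edge []      refl            = [] , ε , refl
  ⟶-derive {G} {G′} 𝐒 edge (x ∷ s) (v , _ , e , p)
    with edge x e | ⟶-derive {G} {G′} 𝐒 edge s p
  ... | t , x⟶t , q | t′ , s⟶t′ , q′ = t ++ t′ , language-++ 𝐒 x⟶t s⟶t′ , ⟶-++ G′ t t′ q q′

  -- Removing an edge concluded by a Horn rule

  -- If `x` reads the active edge from `w` to `u`, the walk is followed as it stands; otherwise it
  -- is reversed. The two productions of the grammar are these two cases.
  active-⟶ : ∀ (G : GSequent) h {w u} (walk : Walk w (body h) u) → atoms walk ⊆ edgeAtoms G →
    ∀ x {v z} → active h w u ≡ atom x v z → G ⊨ v ⟶[ (λ t → hornGrammar h (x , t)) ] z
  active-⟶ G (forward a s)  walk sub (fwd a) refl = s , inj₁ refl , Walk⇒⟶ G walk sub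
  active-⟶ G (forward a s)  walk sub (bwd a) refl = bar* s , inj₂ refl , ⟶-bar* G s (Walk⇒⟶ G walk sub)
  active-⟶ G (backward a s) walk sub (fwd a) refl = bar* s , inj₂ refl , ⟶-bar* G s (Walk⇒⟶ G walk sub)
  active-⟶ G (backward a s) walk sub (bwd a) refl = s , inj₁ refl , Walk⇒⟶ G walk sub

  horn-⟶ : ∀ (𝐒 : ESystem) h {w u} (walk : Walk w (body h) u) →
    (∀ {p} → hornGrammar h p → rules 𝐒 p) →
    atoms walk ⊆ edgeAtoms G′ → edgeAtoms G ⊆ edgeAtoms G′ ∪ ｛ active h w u ｝ →
    ∀ {y z s} → G ⊨ y ⟶[ language 𝐒 s ] z → G′ ⊨ y ⟶[ language 𝐒 s ] z
  horn-⟶ {G′} {G} 𝐒 h walk h⊆𝐒 walk⊆ G⊆ (s , s∈ , p) =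
    -- The string of the path is already derived; rewriting it to `t` only prolongs that derivation.
    let t , s⟶t , q = ⟶-derive {G} {G′} 𝐒 edge s p in t , s∈ ◅◅ s⟶t , q
    where
    edge : ∀ x {v z} → edgeAtoms G (atom x v z) → G′ ⊨ v ⟶[ language 𝐒 [ x ] ] z
    edge x {v} {z} e with G⊆ e
    ... | inj₁ e′ = [ x ] , ε , z , proj₂ (atom-∈⇒𝒱 G′ x e′) , e′ , refl
    ... | inj₂ eq with active-⟶ G′ h walk walk⊆ x eq
    ...   | t , rule , q = t , rule⇒language 𝐒 (h⊆𝐒 rule) , q

  -- The two permutations

  reachability-PermutesAbove-horn : ∀ (r : ReachabilityRule) (H : Pred HornRule 0ℓ) →
    ｛ reachability r ｝ PermutesAbove hornRules H
  -- `NonZero` excludes arity zero, so there is a premise `zero` to take a walk from. Walks may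
  -- differ between premises, but any of them lies in `G`, whose edges all `𝒢′ i` share.
  reachability-PermutesAbove-horn r@(record { n = suc _ }) H _ _ refl (h , _ , refl) 𝒢 G
    (_ , (w′ , u′) , 𝒢′ , horns , (w , u) , Γ , Δ , Sᵢ , Sᵢ′ , S , S′ , premises , (G-edges , G-labels) , paths , sat)
    with horns zero
  ... | walk , Γ₀ , _ , (𝒢₀-edges , _) , (𝒢₀′-edges , _) =
    (λ _ → G⁺) ,
    (λ { zero → (w , u) , edgeAtoms G⁺ , Δ , Sᵢ , Sᵢ′ , S , S′ ,
                (λ i → ≐⇒≐⨄ (𝒢-edges i) , ≐-≐⨄-trans (𝒢-labels i) (proj₂ (premises i))) ,
                (≐⇒≐⨄ ≐-refl , G-labels) ,
                (λ i → let s , s∈ , p = paths i in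
                       s , s∈ , ⟶-mono {𝒢′ i} {𝒢 i zero}
                                  (prefixed-⊆⇒𝒱-⊆ {𝒢′ i} {𝒢 i zero} (proj₂ (𝒢-labels i)))
                                  (proj₂ (𝒢≐𝒢′∪active i) ∘ inj₁) s p) ,
                sat }) ,
    (w′ , u′) , walk , Γ₀ , prefixed G ,
    (≐⨄-extend G≐Γ₀⨄walk 𝒢₀-edges , ≐⇒≐⨄ ≐-refl) ,
    (G≐Γ₀⨄walk , ≐⇒≐⨄ ≐-refl)
    where
    𝒢-labels : ∀ i → prefixed (𝒢 i zero) ≐ prefixed (𝒢′ i)
    𝒢-labels i with horns i
    ... | _ , _ , _ , (_ , above) , (_ , below) = ≐-trans (≐⨄⇒≐ above) (≐-sym (≐⨄⇒≐ below))

    𝒢≐𝒢′∪active : ∀ i → edgeAtoms (𝒢 i zero) ≐ edgeAtoms (𝒢′ i) ∪ ｛ active h w′ u′ ｝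
    𝒢≐𝒢′∪active i with horns i
    ... | _ , _ , _ , (above , _) , (below , _) = ≐⨄-∪ above below

    𝒢′≐G : ∀ i → edgeAtoms (𝒢′ i) ≐ edgeAtoms G
    𝒢′≐G i = ≐-trans (≐⨄⇒≐ (proj₁ (premises i))) (≐-sym (≐⨄⇒≐ G-edges))

    -- The single instance `(w′ , u′)` makes the added atom the same for every `i`, so that the
    -- premises `𝒢 i zero` have a common context.
    𝒢-edges : ∀ i → edgeAtoms (𝒢 i zero) ≐ edgeAtoms G ∪ ｛ active h w′ u′ ｝
    𝒢-edges i = ≐-trans (𝒢≐𝒢′∪active i) (∪-congˡ (𝒢′≐G i))

    𝒱-⊆ : 𝒱 (𝒢 zero zero) ⊆ 𝒱 G
    𝒱-⊆ = relabelling-𝒱-⊆ {𝒢′ zero} {G} (proj₂ (premises zero)) G-labels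
        ∘ prefixed-⊆⇒𝒱-⊆ {𝒢 zero zero} {𝒢′ zero} (proj₁ (𝒢-labels zero))

    G⁺ : GSequent
    -- The endpoints of the restored edge are known to be vertices of `𝒢 zero zero`; `𝒱-⊆` carries
    -- them over to `G`.
    G⁺ = withEdges G (edgeAtoms G ∪ ｛ active h w′ u′ ｝) λ e →
      let v∈ , z∈ = ℰ⊆𝒱×𝒱 (𝒢 zero zero) (proj₂ (𝒢-edges zero) e) in 𝒱-⊆ v∈ , 𝒱-⊆ z∈

    G≐Γ₀⨄walk : edgeAtoms G ≐⨄ Γ₀ ∷ atoms walk ∷ []
    G≐Γ₀⨄walk = ≐-≐⨄-trans (≐-sym (𝒢′≐G zero)) 𝒢₀′-edges

  horn-PermutesAbove-reachability :
    ∀ (r : ReachabilityRule) (H : Pred HornRule 0ℓ) (fin : Finite (hornGrammars H)) →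
    hornRules H PermutesAbove ｛ reachability (r ⊕ 𝐆 H fin) ｝
  horn-PermutesAbove-reachability r H fin _ _ (h , h∈H , refl) refl 𝒢 G
    (_ , (w , u) , 𝒢′ , reaches , (w′ , u′) , walk , Γ₀ , _ , (above-edges , above-labels) , (G-edges , G-labels))
    with reaches zero
  ... | Γ , Δ , Sᵢ , Sᵢ′ , S , S′ , premises , (𝒢′-edges , 𝒢′-labels) , paths , sat =
    𝒢⁻ ,
    -- All premises have the edges of `𝒢′ zero`, so the walk and context found below the
    -- reachability rule serve above it in each of them.
    (λ i → (w′ , u′) , walk , Γ₀ , prefixed (𝒢 zero i) ,
           (≐-≐⨄-trans (𝒢≐𝒢′ i) above-edges , ≐⇒≐⨄ ≐-refl) ,
           (G-edges , ≐⇒≐⨄ ≐-refl)) ,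
    (w , u) , edgeAtoms G , Δ , Sᵢ , Sᵢ′ , S , S′ ,
    (λ i → ≐⇒≐⨄ ≐-refl , proj₂ (premises i)) ,
    (≐⇒≐⨄ ≐-refl , ≐-≐⨄-trans G≐𝒢′-labels 𝒢′-labels) ,
    (λ i → horn-⟶ {𝒢⁻ i} {𝒢 zero i} (system i ∪ᴳ 𝐆 H fin) h walk
             -- The absorbed grammar supplies the productions of `h`. The walk itself survives the
             -- removal, since its atoms belong to `G`.
             (λ rule → inj₂ (h , h∈H , rule))
             (proj₂ (proj₁ G-edges) ∘ inj₂ ∘ inj₁) (proj₁ (𝒢≐G∪active i))
             (paths i)) ,
    sat
    where
    open ReachabilityRule r

    𝒢≐𝒢′ : ∀ i → edgeAtoms (𝒢 zero i) ≐ edgeAtoms (𝒢′ zero)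
    𝒢≐𝒢′ i = ≐-trans (≐⨄⇒≐ (proj₁ (premises i))) (≐-sym (≐⨄⇒≐ 𝒢′-edges))

    𝒢≐G∪active : ∀ i → edgeAtoms (𝒢 zero i) ≐ edgeAtoms G ∪ ｛ active h w′ u′ ｝
    𝒢≐G∪active i = ≐-trans (𝒢≐𝒢′ i) (≐⨄-∪ above-edges G-edges)

    G≐𝒢′-labels : prefixed G ≐ prefixed (𝒢′ zero)
    G≐𝒢′-labels = ≐-trans (≐⨄⇒≐ G-labels) (≐-sym (≐⨄⇒≐ above-labels))

    𝒢⁻ : Fin n → GSequent
    𝒢⁻ i = withEdges (𝒢 zero i) (edgeAtoms G) λ e →
      ℰ⊆𝒱×𝒱 (𝒢 zero i) (proj₂ (𝒢≐G∪active i) (inj₁ e))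

mainTheorem3 : (Sig : Signature) → let open Calculus Sig in
    (r : ReachabilityRule) (H : Pred HornRule 0ℓ) (fin : Finite (hornGrammars H)) →
    Permutable ｛ reachability (r ⊕ 𝐆 H fin) ｝ (hornRules H)
mainTheorem3 Sig r H fin =
  reachability-PermutesAbove-horn (r ⊕ 𝐆 H fin) H , horn-PermutesAbove-reachability r H fin
  where open Calculus Sig
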